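{- A field carrying an $\omega$-homogeneous pregeometry is algebraically closed.
   Context: An infinite model (structure) $M$ carries an $\omega$-homogeneous pregeometry if there is an invariant closure operator $\mathrm{cl}:\mathcal{P}(M)\to\mathcal{P}(M)$ (invariant under automorphisms of $M$) satisfying the axioms of a pregeometry, with $\dim(M)=\|M\|$, and such that whenever $A\subseteq M$ is finite and $a,b\notin\mathrm{cl}(A)$ there is an automorphism of $M$ preserving $\mathrm{cl}$, fixing $A$ pointwise, and sending $a$ to $b$. Here $M$ is the field. -}

module Defs where

open import Level using (Level; _⊔_; suc)
open import Algebra.Apartness.Bundles using (HeytingField; HeytingCommutativeRing)
open import Algebra.Bundles using (CommutativeRing)
open import Algebra.Morphism.Structures using (module RingMorphisms)
open import Data.List.Base using (List; _∷_; foldr)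
open import Data.List.Relation.Unary.All using (All)
open import Data.List.Relation.Unary.Any using (Any)
open import Data.List.Relation.Unary.Enumerates.Setoid using (IsEnumeration)
import Data.List.Membership.Setoid as Membership
open import Data.Product.Base using (∃; ∃-syntax; _×_; proj₁)
open import Function.Bundles using (Bijection)
open import Relation.Binary.Bundles using (Setoid)
open import Relation.Binary.Definitions using (_Respects_)
import Relation.Binary.Construct.On as On
open import Relation.Nullary.Negation using (¬_)
open import Relation.Unary using (Pred; _∈_; _∉_; _⊆_; _≐_; _∪_)

private
  variable
    c ℓ ℓ₁ ℓ₂ : Level

Infinite : Setoid c ℓ → Set (c ⊔ ℓ)
Infinite S = ¬ ∃ (IsEnumeration S)

module _ (S : Setoid c ℓ) where
  open Setoid S

  Subset : Set (suc (c ⊔ ℓ))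
  Subset = Pred Carrier (c ⊔ ℓ)

  ⟪_⟫ : List Carrier → Subset
  ⟪ xs ⟫ = λ x → Membership._∈_ S x xs

  _∖_ : Subset → Carrier → Subset
  A ∖ b = λ x → x ∈ A × ¬ (x ≈ b)

  -- A predicate denotes the set of elements ≈-equal to some member of it, so
  -- closed sets must respect ≈.  By extensive, monotone and idempotent, cl A
  -- then depends only on that saturation of A, even if A does not respect ≈.
  record Pregeometry : Set (suc (c ⊔ ℓ)) where
    field
      cl         : Subset → Subset
      cl-resp-≈  : ∀ A → cl A Respects _≈_
      extensive  : ∀ A → A ⊆ cl A
      monotone   : ∀ {A B} → A ⊆ B → cl A ⊆ cl B
      idempotent : ∀ A → cl (cl A) ⊆ cl A
      finitary   : ∀ A {a} → a ∈ cl A → ∃[ xs ] All A xs × a ∈ cl ⟪ xs ⟫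
      exchange   : ∀ A {a b} → a ∈ cl (A ∪ (_≈ b)) → a ∉ cl A →
                   b ∈ cl (A ∪ (_≈ a))

    Independent : Subset → Set (c ⊔ ℓ)
    Independent B = ∀ {b} → b ∈ B → b ∉ cl (B ∖ b)

    Spanning : Subset → Set (c ⊔ ℓ)
    Spanning B = ∀ x → x ∈ cl B

    IsBasis : Subset → Set (c ⊔ ℓ)
    IsBasis B = Independent B × Spanning B

    subsetSetoid : Subset → Setoid (c ⊔ ℓ) ℓ
    subsetSetoid B = On.setoid {B = ∃ B} S proj₁

    -- dim = κ means that some (equivalently, every) basis has cardinality κ.
    HasDimension : ∀ {k ℓₖ} → Setoid k ℓₖ → Set (suc (c ⊔ ℓ) ⊔ k ⊔ ℓₖ)
    HasDimension κ = ∃[ B ] IsBasis B × Bijection (subsetSetoid B) κ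

-- In a Heyting field x # y means that x - y is invertible, and # is irreflexive,
-- so 0# is not invertible and the zero ring is excluded.  Under excluded middle,
-- tightness makes # the negation of ≈, so these are exactly the classical fields.
module _ (K : HeytingField c ℓ₁ ℓ₂) where
  open HeytingField K
  open HeytingCommutativeRing heytingCommutativeRing using (commutativeRing)
  open CommutativeRing commutativeRing using (rawRing)

  record Automorphism : Set (c ⊔ ℓ₁) where
    field
      ⟦_⟧               : Carrier → Carrier
      isRingIsomorphism : RingMorphisms.IsRingIsomorphism rawRing rawRing ⟦_⟧

    image : Subset setoid → Subset setoid
    image A = λ y → ∃[ x ] x ∈ A × ⟦ x ⟧ ≈ y

    Preserves : Pregeometry setoid → Set (suc (c ⊔ ℓ₁))
    Preserves P = ∀ A → image (cl A) ≐ cl (image A)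
      where open Pregeometry P

    Fixes : Subset setoid → Set (c ⊔ ℓ₁)
    Fixes A = ∀ {x} → x ∈ A → ⟦ x ⟧ ≈ x

  record ωHomogeneousPregeometry : Set (suc (c ⊔ ℓ₁)) where
    field
      infinite    : Infinite setoid
      pregeometry : Pregeometry setoid

    open Pregeometry pregeometry public
    open Automorphism

    field
      invariant     : ∀ σ → Preserves σ pregeometry
      dimension     : HasDimension setoid
      ω-homogeneous : ∀ xs {a b} → a ∉ cl (⟪_⟫ setoid xs) → b ∉ cl (⟪_⟫ setoid xs) →
                      ∃[ σ ] Preserves σ pregeometry
                           × Fixes σ (⟪_⟫ setoid xs)
                           × ⟦ σ ⟧ a ≈ b

  -- Coefficients are listed from the constant term upwards.
  eval : List Carrier → Carrier → Carrier
  eval p x = foldr (λ a r → a + x * r) 0# p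

  -- a ∷ p with some nonzero entry in p is a polynomial of degree at least 1;
  -- leading (trailing-in-the-list) zero coefficients are allowed.
  AlgebraicallyClosed : Set (c ⊔ ℓ₁)
  AlgebraicallyClosed = ∀ a p → Any (λ b → ¬ (b ≈ 0#)) p →
                        ∃[ x ] eval (a ∷ p) x ≈ 0#

{-# OPTIONS --safe #-}

-- Algebraic elements lie in the closure: an element outside cl A, for finite A,
-- has infinitely many conjugates over A, because K is infinite-dimensional.
-- Let f be a monic polynomial of least degree N ≥ 2 without a root.  Lower
-- degrees split, so L = K[X]/(f) is a domain.  Let β ∈ L have coordinates
-- independent over the coefficients A of f.  By linear algebra some monic g over
-- K of degree at most N has g(β) = 0.  If its degree is N, then, g having
-- finitely many roots in the domain L, the N coordinates of β are algebraic over
-- A and the N coefficients of g, which are therefore independent over A.  So are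
-- the coefficients of ∏ (X - rᵢ) for independent r₁, …, r_N, and an automorphism
-- over A takes these to the coefficients of g.  Hence g splits over K in every
-- case, and β ∈ K because L is a domain, a contradiction.
--
-- As K is infinite, a polynomial is identified with the function it induces.
module Submission where

open import Defs
open import Level using (Level; _⊔_) renaming (suc to lsuc)
open import Algebra.Apartness.Bundles using (HeytingField; HeytingCommutativeRing)
import Algebra.Apartness.Properties.HeytingCommutativeRing as HeytingProperties
open import Algebra.Bundles using (CommutativeRing)
import Algebra.Morphism.Construct.Composition as Composition
import Algebra.Morphism.Construct.Identity as Identity
open import Algebra.Morphism.Structures using (module RingMorphisms)
open import Axiom.ExcludedMiddle using (ExcludedMiddle)
open import Data.Empty using (⊥)
open import Data.Integer.Base as ℤ using (ℤ; 0ℤ; 1ℤ)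
import Data.Integer.Properties as ℤ
open import Data.List.Base as List using (List; []; _∷_; _++_; length; upTo)
import Data.List.Properties as List
open import Data.List.Membership.Propositional using (find) renaming (_∈_ to _∈≡_)
open import Data.List.Membership.Propositional.Properties using (∈-upTo⁻)
import Data.List.Membership.Setoid as SetoidMembership
import Data.List.Membership.Setoid.Properties as Membership
open import Data.List.Relation.Binary.Subset.Propositional using () renaming (_⊆_ to _⊆ₗ_)
open import Data.List.Relation.Binary.Subset.Propositional.Properties
  using (All-resp-⊇; Any-resp-⊆; ∷⁺ʳ; xs⊆x∷xs)
open import Data.List.Relation.Unary.All as All using (All; []; _∷_)
import Data.List.Relation.Unary.All.Properties as All
open import Data.List.Relation.Unary.AllPairs using (AllPairs; []; _∷_)
import Data.List.Relation.Unary.AllPairs.Properties as AllPairs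
open import Data.List.Relation.Unary.Any as Any using (Any; here; there)
open import Data.Maybe.Base using (Maybe; just; nothing)
open import Data.Nat.Base as ℕ using (ℕ; zero; suc; z≤n; s≤s)
open import Data.Nat.Induction using (<-rec)
import Data.Nat.Properties as ℕ
open import Data.Product.Base using (∃; ∃-syntax; _×_; _,_; proj₁; proj₂)
open import Data.Sum.Base as Sum using (_⊎_; inj₁; inj₂)
open import Data.Unit.Polymorphic.Base using (⊤; tt)
open import Data.Vec.Base as Vec using (Vec; []; _∷_; fromList; toList)
import Data.Vec.Properties as Vec
open import Data.Vec.Relation.Binary.Pointwise.Inductive using (Pointwise; []; _∷_)
open import Data.Vec.Relation.Unary.All as VecAll using ([]; _∷_)
open import Function.Base using (_∘_; id)
open import Function.Bundles using (Bijection)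
open import Relation.Binary.Bundles using (Setoid)
open import Relation.Binary.PropositionalEquality.Core as ≡ using (_≡_)
open import Relation.Nullary using (yes; no; contradiction)
open import Relation.Nullary.Decidable using (decidable-stable)
open import Relation.Nullary.Negation using (¬_)
open import Relation.Unary using (_∈_; _∉_; _⊆_)

private
  variable
    c ℓ ℓ₁ ℓ₂ : Level

-- Integer coefficients let the solver cancel x - x, which the solver without
-- decidable coefficients cannot.
module RingSolver (R : CommutativeRing c ℓ) where
  open CommutativeRing R
  open import Algebra.Properties.Ring ring
  open import Algebra.Properties.AbelianGroup +-abelianGroup using (⁻¹-∙-comm)
  open import Algebra.Properties.Semiring.Mult.TCOptimised semiring
    using (×-homo-+; ×1-homo-*) renaming (_×_ to _×ₙ_)
  open import Algebra.Solver.Ring.AlmostCommutativeRing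
    using (AlmostCommutativeRing; _-Raw-AlmostCommutative⟶_)
  open import Relation.Binary.Reasoning.Setoid setoid

  almostCommutativeRing : AlmostCommutativeRing c ℓ
  almostCommutativeRing = record
    { isAlmostCommutativeRing = record
      { isCommutativeSemiring = isCommutativeSemiring
      ; -‿cong                = -‿cong
      ; -‿*-distribˡ          = λ x y → sym (-‿distribˡ-* x y)
      ; -‿+-comm              = ⁻¹-∙-comm
      }
    }

  ι : ℤ → Carrier
  ι (ℤ.+ n)    = n ×ₙ 1#
  ι ℤ.-[1+ n ] = - (suc n ×ₙ 1#)

  ι-⊖ : ∀ m n → ι (m ℤ.⊖ n) ≈ m ×ₙ 1# - n ×ₙ 1#
  ι-⊖ m       zero    = sym (trans (+-congˡ -0#≈0#) (+-identityʳ _))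
  ι-⊖ zero    (suc n) = sym (+-identityˡ _)
  ι-⊖ (suc m) (suc n) = begin
    ι (suc m ℤ.⊖ suc n)                     ≡⟨ ≡.cong ι (ℤ.[1+m]⊖[1+n]≡m⊖n m n) ⟩
    ι (m ℤ.⊖ n)                             ≈⟨ ι-⊖ m n ⟩
    m ×ₙ 1# - n ×ₙ 1#                         ≈⟨ +-congʳ (+-identityˡ _) ⟨
    0# + m ×ₙ 1# - n ×ₙ 1#                    ≈⟨ +-congʳ (+-congʳ (-‿inverseʳ 1#)) ⟨
    1# - 1# + m ×ₙ 1# - n ×ₙ 1#               ≈⟨ +-congʳ (+-assoc 1# (- 1#) (m ×ₙ 1#)) ⟩
    1# + (- 1# + m ×ₙ 1#) - n ×ₙ 1#           ≈⟨ +-congʳ (+-congˡ (+-comm (- 1#) (m ×ₙ 1#))) ⟩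
    1# + (m ×ₙ 1# - 1#) - n ×ₙ 1#             ≈⟨ +-congʳ (+-assoc 1# (m ×ₙ 1#) (- 1#)) ⟨
    1# + m ×ₙ 1# - 1# - n ×ₙ 1#               ≈⟨ +-assoc _ (- 1#) (- (n ×ₙ 1#)) ⟩
    1# + m ×ₙ 1# + (- 1# - n ×ₙ 1#)           ≈⟨ +-congˡ (⁻¹-∙-comm 1# (n ×ₙ 1#)) ⟩
    1# + m ×ₙ 1# - (1# + n ×ₙ 1#)
      ≈⟨ +-cong (×-homo-+ 1# 1 m) (-‿cong (×-homo-+ 1# 1 n)) ⟨
    suc m ×ₙ 1# - suc n ×ₙ 1#                 ∎

  ι-+ : ∀ i j → ι (i ℤ.+ j) ≈ ι i + ι j
  ι-+ (ℤ.+ m)    (ℤ.+ n)    = ×-homo-+ 1# m n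
  ι-+ (ℤ.+ m)    ℤ.-[1+ n ] = ι-⊖ m (suc n)
  ι-+ ℤ.-[1+ m ] (ℤ.+ n)    = trans (ι-⊖ n (suc m)) (+-comm _ _)
  ι-+ ℤ.-[1+ m ] ℤ.-[1+ n ] = begin
    - (suc (suc (m ℕ.+ n)) ×ₙ 1#)      ≡⟨ ≡.cong (λ k → - (k ×ₙ 1#)) (ℕ.+-suc (suc m) n) ⟨
    - ((suc m ℕ.+ suc n) ×ₙ 1#)        ≈⟨ -‿cong (×-homo-+ 1# (suc m) (suc n)) ⟩
    - (suc m ×ₙ 1# + suc n ×ₙ 1#)       ≈⟨ ⁻¹-∙-comm _ _ ⟨
    - (suc m ×ₙ 1#) - suc n ×ₙ 1#       ∎

  ι-neg : ∀ i → ι (ℤ.- i) ≈ - ι i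
  ι-neg (ℤ.+ zero)  = sym -0#≈0#
  ι-neg (ℤ.+ suc n) = refl
  ι-neg ℤ.-[1+ n ]  = sym (-‿involutive _)

  ι-*⁺ : ∀ m j → ι (ℤ.+ m ℤ.* j) ≈ m ×ₙ 1# * ι j
  ι-*⁺ m (ℤ.+ n) = trans (reflexive (≡.cong ι (≡.sym (ℤ.pos-* m n)))) (×1-homo-* m n)
  ι-*⁺ m ℤ.-[1+ n ] = begin
    ι (ℤ.+ m ℤ.* ℤ.-[1+ n ])          ≡⟨ ≡.cong ι (ℤ.neg-distribʳ-* (ℤ.+ m) (ℤ.+ suc n)) ⟨
    ι (ℤ.- (ℤ.+ m ℤ.* ℤ.+ suc n))     ≈⟨ ι-neg (ℤ.+ m ℤ.* ℤ.+ suc n) ⟩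
    - ι (ℤ.+ m ℤ.* ℤ.+ suc n)         ≈⟨ -‿cong (ι-*⁺ m (ℤ.+ suc n)) ⟩
    - (m ×ₙ 1# * (suc n ×ₙ 1#))         ≈⟨ -‿distribʳ-* _ _ ⟩
    m ×ₙ 1# * - (suc n ×ₙ 1#)           ∎

  ι-* : ∀ i j → ι (i ℤ.* j) ≈ ι i * ι j
  ι-* (ℤ.+ m)    j = ι-*⁺ m j
  ι-* ℤ.-[1+ m ] j = begin
    ι (ℤ.-[1+ m ] ℤ.* j)          ≡⟨ ≡.cong ι (ℤ.neg-distribˡ-* (ℤ.+ suc m) j) ⟨
    ι (ℤ.- (ℤ.+ suc m ℤ.* j))     ≈⟨ ι-neg (ℤ.+ suc m ℤ.* j) ⟩
    - ι (ℤ.+ suc m ℤ.* j)         ≈⟨ -‿cong (ι-*⁺ (suc m) j) ⟩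
    - (suc m ×ₙ 1# * ι j)          ≈⟨ -‿distribˡ-* _ _ ⟩
    - (suc m ×ₙ 1#) * ι j          ∎

  ι-morphism : ℤ.+-*-rawRing -Raw-AlmostCommutative⟶ almostCommutativeRing
  ι-morphism = record
    { ⟦_⟧ = ι ; +-homo = ι-+ ; *-homo = ι-* ; -‿homo = ι-neg ; 0-homo = refl ; 1-homo = refl }

  -- Comparing the integers themselves is enough: in positive characteristic distinct integers may
  -- have equal images, but only positive answers have to be correct.
  ι-≟ : ∀ i j → Maybe (ι i ≈ ι j)
  ι-≟ i j with i ℤ.≟ j
  ... | yes i≡j = just (reflexive (≡.cong ι i≡j))
  ... | no  _   = nothing

  open import Algebra.Solver.Ring ℤ.+-*-rawRing almostCommutativeRing ι-morphism ι-≟ public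
    using (solve; _:=_; _:+_; _:*_; _:-_; :-_; con)

-- Polynomial functions over a commutative ring.

module Polynomials (R : CommutativeRing c ℓ) where
  open CommutativeRing R
  open RingSolver R
  open import Relation.Binary.Reasoning.Setoid setoid

  open SetoidMembership setoid using () renaming (_∈_ to _∈ₗ_)

  private
    variable
      m n : ℕ
      φ ψ : Carrier → Carrier

  -- The coefficient `b` above the listed ones is a parameter, so that polynomials of degree below n
  -- and monic polynomials of degree n share their lemmas.
  horner : Carrier → Vec Carrier n → Carrier → Carrier
  horner b []       x = b
  horner b (a ∷ as) x = a + x * horner b as x

  poly monic : Vec Carrier n → Carrier → Carrier
  poly  = horner 0#
  monic = horner 1#

  -- Degree bounds are properties of functions, with the coefficients as an existential witness, so
  -- that sums and products are simply pointwise and leading zeros are harmless.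
  Degree< : ℕ → (Carrier → Carrier) → Set (c ⊔ ℓ)
  Degree< n φ = ∃[ p ] ∀ x → φ x ≈ poly {n} p x

  Monic : ℕ → (Carrier → Carrier) → Set (c ⊔ ℓ)
  Monic n φ = ∃[ p ] ∀ x → φ x ≈ monic {n} p x

  IsPoly : (Carrier → Carrier) → Set (c ⊔ ℓ)
  IsPoly φ = ∃[ n ] Degree< n φ

  horner-cong : ∀ {b} {p q : Vec Carrier n} {x y} →
                Pointwise _≈_ p q → x ≈ y → horner b p x ≈ horner b q y
  horner-cong []            x≈y = refl
  horner-cong (a≈a′ ∷ p≈p′) x≈y = +-cong a≈a′ (*-cong x≈y (horner-cong p≈p′ x≈y))

  ≋-refl : ∀ {p : Vec Carrier n} → Pointwise _≈_ p p
  ≋-refl {p = []}    = []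
  ≋-refl {p = _ ∷ _} = refl ∷ ≋-refl

  horner-congʳ : ∀ {b} (p : Vec Carrier n) {x y} → x ≈ y → horner b p x ≈ horner b p y
  horner-congʳ p = horner-cong (≋-refl {p = p})

  Degree<-resp : (∀ x → φ x ≈ ψ x) → Degree< n φ → Degree< n ψ
  Degree<-resp φ≈ψ (p , φ≈p) = p , λ x → trans (sym (φ≈ψ x)) (φ≈p x)

  Monic-resp : (∀ x → φ x ≈ ψ x) → Monic n φ → Monic n ψ
  Monic-resp φ≈ψ (p , φ≈p) = p , λ x → trans (sym (φ≈ψ x)) (φ≈p x)

  Degree<-∷ : ∀ a → Degree< n φ → Degree< (suc n) (λ x → a + x * φ x)
  Degree<-∷ a (p , φ≈p) = a ∷ p , λ x → +-congˡ (*-congˡ (φ≈p x))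

  Monic-∷ : ∀ a → Monic n φ → Monic (suc n) (λ x → a + x * φ x)
  Monic-∷ a (p , φ≈p) = a ∷ p , λ x → +-congˡ (*-congˡ (φ≈p x))

  Degree<-zero : ∀ n → Degree< n (λ _ → 0#)
  Degree<-zero zero    = [] , λ _ → refl
  Degree<-zero (suc n) = Degree<-resp
    (solve 1 (λ x → con 0ℤ :+ x :* con 0ℤ := con 0ℤ) refl) (Degree<-∷ 0# (Degree<-zero n))

  poly-≤ : m ℕ.≤ n → (p : Vec Carrier m) → Degree< n (poly p)
  poly-≤ z≤n       []      = Degree<-zero _
  poly-≤ (s≤s m≤n) (a ∷ p) = Degree<-∷ a (poly-≤ m≤n p)

  Degree<-≤ : m ℕ.≤ n → Degree< m φ → Degree< n φ
  Degree<-≤ m≤n (p , φ≈p) = Degree<-resp (λ x → sym (φ≈p x)) (poly-≤ m≤n p)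

  horner-+ : ∀ b (p q : Vec Carrier n) x →
             horner b p x + poly q x ≈ horner b (Vec.zipWith _+_ p q) x
  horner-+ b []      []       x = +-identityʳ b
  horner-+ b (a ∷ p) (a′ ∷ q) x = begin
    (a + x * horner b p x) + (a′ + x * poly q x)
      ≈⟨ solve 5 (λ a x u a′ v → (a :+ x :* u) :+ (a′ :+ x :* v) :=
                                 (a :+ a′) :+ x :* (u :+ v)) refl _ _ _ _ _ ⟩
    (a + a′) + x * (horner b p x + poly q x)
      ≈⟨ +-congˡ (*-congˡ (horner-+ b p q x)) ⟩
    (a + a′) + x * horner b (Vec.zipWith _+_ p q) x ∎

  Degree<-+ : Degree< n φ → Degree< n ψ → Degree< n (λ x → φ x + ψ x)
  Degree<-+ (p , φ≈p) (q , ψ≈q) =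
    Vec.zipWith _+_ p q , λ x → trans (+-cong (φ≈p x) (ψ≈q x)) (horner-+ 0# p q x)

  Monic-+ : Monic n φ → Degree< n ψ → Monic n (λ x → φ x + ψ x)
  Monic-+ (p , φ≈p) (q , ψ≈q) =
    Vec.zipWith _+_ p q , λ x → trans (+-cong (φ≈p x) (ψ≈q x)) (horner-+ 1# p q x)

  Degree<-scale : ∀ a → Degree< n φ → Degree< n (λ x → a * φ x)
  Degree<-scale a (p , φ≈p) = Degree<-resp (λ x → *-congˡ (sym (φ≈p x))) (scale p)
    where
    scale : (p : Vec Carrier n) → Degree< n (λ x → a * poly p x)
    scale []      = [] , λ _ → zeroʳ a
    scale (b ∷ p) = Degree<-resp
      (λ x → solve 4 (λ a b x u → a :* b :+ x :* (a :* u) := a :* (b :+ x :* u)) refl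
               a b x (poly p x))
      (Degree<-∷ (a * b) (scale p))

  Degree<-linear : ∀ a → Degree< n φ → Degree< n ψ → Degree< n (λ x → φ x + a * ψ x)
  Degree<-linear a dφ dψ = Degree<-+ dφ (Degree<-scale a dψ)

  Monic⇒Degree< : Monic n φ → Degree< (suc n) φ
  Monic⇒Degree< (p , φ≈p) = Degree<-resp (λ x → sym (φ≈p x)) (go p)
    where
    go : (p : Vec Carrier n) → Degree< (suc n) (monic p)
    go []      = 1# ∷ [] , solve 1 (λ x → con 1ℤ := con 1ℤ :+ x :* con 0ℤ) refl
    go (a ∷ p) = Degree<-∷ a (go p)

  Monic-* : Monic m φ → Monic n ψ → Monic (m ℕ.+ n) (λ x → φ x * ψ x)
  Monic-* {n = n} {ψ = ψ} (p , φ≈p) mψ =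
    Monic-resp (λ x → *-congʳ (sym (φ≈p x))) (go p)
    where
    go : ∀ {m} (p : Vec Carrier m) → Monic (m ℕ.+ n) (λ x → monic p x * ψ x)
    go []      = Monic-resp (λ x → sym (*-identityˡ _)) mψ
    go {suc m} (a ∷ p) = Monic-resp
      (λ x → solve 4 (λ a x u v → (con 0ℤ :+ x :* (u :* v)) :+ a :* v := (a :+ x :* u) :* v)
               refl a x (monic p x) (ψ x))
      -- The summand `a * ψ` has degree at most n, below the degree m + n + 1 of the other summand.
      (Monic-+ (Monic-∷ 0# (go p))
               (Degree<-scale a (Degree<-≤ (s≤s (ℕ.m≤n+m n m)) (Monic⇒Degree< mψ))))

  monic-X-a : ∀ a → Monic 1 (_- a)
  monic-X-a a = - a ∷ [] , solve 2 (λ a x → x :- a := :- a :+ x :* con 1ℤ) refl a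

  ∏X-_ : Vec Carrier n → Carrier → Carrier
  (∏X- [])       x = 1#
  (∏X- (r ∷ rs)) x = (x - r) * (∏X- rs) x

  monic-∏ : (rs : Vec Carrier n) → Monic n (∏X- rs)
  monic-∏ []       = [] , λ _ → refl
  monic-∏ (r ∷ rs) = Monic-* (monic-X-a r) (monic-∏ rs)

  ∏-root : (rs : Vec Carrier n) → ∀ {a} → a ∈ₗ toList rs → (∏X- rs) a ≈ 0#
  ∏-root (r ∷ rs) (here a≈r) =
    trans (*-congʳ (trans (+-congʳ a≈r) (-‿inverseʳ r))) (zeroˡ _)
  ∏-root (r ∷ rs) (there a∈) = trans (*-congˡ (∏-root rs a∈)) (zeroʳ _)

  ∏-congʳ : (rs : Vec Carrier n) → ∀ {x y} → x ≈ y → (∏X- rs) x ≈ (∏X- rs) y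
  ∏-congʳ []       x≈y = refl
  ∏-congʳ (r ∷ rs) x≈y = *-cong (+-congʳ x≈y) (∏-congʳ rs x≈y)

  -- One step of long division: the degree of `p` is at most that of `f`, so the quotient is a
  -- constant, the top coefficient of `p`.
  divide-leading : (p : Vec Carrier (suc n)) (f : Vec Carrier n) →
                   ∃[ u ] Degree< n (λ x → poly p x - u * monic f x)
  divide-leading (a ∷ []) [] =
    a , [] , solve 2 (λ a x → (a :+ x :* con 0ℤ) :- a :* con 1ℤ := con 0ℤ) refl a
  divide-leading (a ∷ p@(_ ∷ _)) (b ∷ f) with u , r ← divide-leading p f =
    u , Degree<-resp
      (λ x → solve 6 (λ a u b x p f → (a :- u :* b) :+ x :* (p :- u :* f) :=
                                      (a :+ x :* p) :- u :* (b :+ x :* f)) refl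
               a u b x (poly p x) (monic f x))
      (Degree<-∷ (a - u * b) r)

  -- Synthetic division: the coefficients of the quotient are the intermediate values of Horner's
  -- scheme for `f` at `γ`.
  factor : (f : Vec Carrier (suc n)) (γ : Carrier) →
           ∃[ q ] ∀ x → monic f x - monic f γ ≈ (x - γ) * monic {n} q x
  factor (a ∷ []) γ =
    [] , λ x → solve 3 (λ a x γ → (a :+ x :* con 1ℤ) :- (a :+ γ :* con 1ℤ) := (x :- γ) :* con 1ℤ)
                 refl a x γ
  factor (a ∷ f@(_ ∷ _)) γ with q , f≈ ← factor f γ = monic f γ ∷ q , λ x → begin
    (a + x * monic f x) - (a + γ * monic f γ)
      ≈⟨ solve 5 (λ a x γ u v → (a :+ x :* u) :- (a :+ γ :* v) :=
                                x :* (u :- v) :+ (x :- γ) :* v) refl _ _ _ _ _ ⟩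
    x * (monic f x - monic f γ) + (x - γ) * monic f γ
      ≈⟨ +-congʳ (*-congˡ (f≈ x)) ⟩
    x * ((x - γ) * monic q x) + (x - γ) * monic f γ
      ≈⟨ solve 4 (λ x γ w v → x :* ((x :- γ) :* w) :+ (x :- γ) :* v :=
                              (x :- γ) :* (v :+ x :* w)) refl _ _ _ _ ⟩
    (x - γ) * (monic f γ + x * monic q x) ∎

  factor-root : (f : Vec Carrier (suc n)) {γ : Carrier} → monic f γ ≈ 0# →
                ∃[ q ] ∀ x → monic f x ≈ (x - γ) * monic {n} q x
  factor-root f {γ} fγ≈0 with q , f≈ ← factor f γ = q , λ x → begin
    monic f x               ≈⟨ solve 1 (λ u → u := u :- con 0ℤ) refl _ ⟩
    monic f x - 0#          ≈⟨ +-congˡ (-‿cong fγ≈0) ⟨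
    monic f x - monic f γ   ≈⟨ f≈ x ⟩
    (x - γ) * monic q x     ∎

  x-y≈0⇒x≈y : ∀ {x y} → x - y ≈ 0# → x ≈ y
  x-y≈0⇒x≈y {x} {y} x-y≈0 = begin
    x             ≈⟨ solve 2 (λ x y → x := (x :- y) :+ y) refl x y ⟩
    (x - y) + y   ≈⟨ +-congʳ x-y≈0 ⟩
    0# + y        ≈⟨ +-identityˡ y ⟩
    y             ∎

  IsPoly-resp : (∀ x → φ x ≈ ψ x) → IsPoly φ → IsPoly ψ
  IsPoly-resp φ≈ψ (n , d) = n , Degree<-resp φ≈ψ d

  IsPoly-const : ∀ a → IsPoly (λ _ → a)
  IsPoly-const a = 1 , a ∷ [] , λ x → solve 2 (λ a x → a := a :+ x :* con 0ℤ) refl a x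

  IsPoly-+ : IsPoly φ → IsPoly ψ → IsPoly (λ x → φ x + ψ x)
  IsPoly-+ (m , dφ) (n , dψ) =
    m ℕ.⊔ n , Degree<-+ (Degree<-≤ (ℕ.m≤m⊔n m n) dφ) (Degree<-≤ (ℕ.m≤n⊔m m n) dψ)

  IsPoly-X* : IsPoly φ → IsPoly (λ x → x * φ x)
  IsPoly-X* (n , d) = suc n , Degree<-resp (λ x → +-identityˡ _) (Degree<-∷ 0# d)

  IsPoly-* : IsPoly φ → IsPoly ψ → IsPoly (λ x → φ x * ψ x)
  IsPoly-* {ψ = ψ} (_ , p , φ≈p) ψ-poly@(n , dψ) =
    IsPoly-resp (λ x → *-congʳ (sym (φ≈p x))) (go p)
    where
    go : ∀ {m} (p : Vec Carrier m) → IsPoly (λ x → poly p x * ψ x)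
    go []      = IsPoly-resp (λ x → sym (zeroˡ _)) (IsPoly-const 0#)
    go (a ∷ p) = IsPoly-resp
      (λ x → solve 4 (λ a x p v → a :* v :+ x :* (p :* v) := (a :+ x :* p) :* v) refl
               a x (poly p x) (ψ x))
      (IsPoly-+ (n , Degree<-scale a dψ) (IsPoly-X* (go p)))

  IsPoly-neg : IsPoly φ → IsPoly (λ x → - φ x)
  IsPoly-neg φ-poly = IsPoly-resp (λ x → solve 1 (λ u → (:- con 1ℤ) :* u := :- u) refl _)
                        (IsPoly-* (IsPoly-const (- 1#)) φ-poly)

  IsPoly-poly : (p : Vec Carrier n) → IsPoly (poly p)
  IsPoly-poly p = _ , p , λ _ → refl

  IsPoly-monic : (p : Vec Carrier n) → IsPoly (monic p)
  IsPoly-monic p = _ , Monic⇒Degree< (p , λ _ → refl)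

  -- Roots over a domain.

  module Domain
    (em   : ExcludedMiddle (c ⊔ ℓ))
    (1≉0  : ¬ 1# ≈ 0#)
    (xy≈0 : ∀ {x y} → x * y ≈ 0# → x ≈ 0# ⊎ y ≈ 0#)
    where
    -- In a domain, a root other than `γ` is a root of the quotient by x - γ, whose degree is
    -- smaller.
    roots : (f : Vec Carrier n) → ∃[ rs ] ∀ {x} → monic f x ≈ 0# → x ∈ₗ rs
    roots [] = [] , λ 1≈0 → contradiction 1≈0 1≉0
    roots f@(_ ∷ _) with em {∃[ γ ] monic f γ ≈ 0#}
    ... | no  none = [] , λ fx≈0 → contradiction (_ , fx≈0) none
    ... | yes (γ , fγ≈0) with q , f≈ ← factor-root f fγ≈0 with rs , all ← roots q =
      γ ∷ rs , λ {x} fx≈0 → case (xy≈0 (trans (sym (f≈ x)) fx≈0))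
      where
      case : ∀ {x} → x - γ ≈ 0# ⊎ monic q x ≈ 0# → x ∈ₗ γ ∷ rs
      case (inj₁ x-γ≈0) = here (x-y≈0⇒x≈y x-γ≈0)
      case (inj₂ qx≈0)  = there (all qx≈0)

    roots-∏ : (rs : Vec Carrier n) → ∀ {x} → (∏X- rs) x ≈ 0# → x ∈ₗ toList rs
    roots-∏ []       1≈0 = contradiction 1≈0 1≉0
    roots-∏ (r ∷ rs) eq with xy≈0 eq
    ... | inj₁ x-r≈0 = here (x-y≈0⇒x≈y x-r≈0)
    ... | inj₂ rest  = there (roots-∏ rs rest)

-- Fields and linear algebra.

module Field (em : ∀ {ℓ} → ExcludedMiddle ℓ) (K : HeytingField c ℓ₁ ℓ₂) where
  open HeytingField K using (heytingCommutativeRing; tight; #⇒invertible)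
  open HeytingCommutativeRing heytingCommutativeRing using (commutativeRing)
  open CommutativeRing commutativeRing
  open HeytingProperties heytingCommutativeRing using (1#0; x-0≈x)
  open RingSolver commutativeRing
  open Polynomials commutativeRing
  open import Relation.Binary.Reasoning.Setoid setoid

  private
    variable
      k m n : ℕ
      φ ψ : Carrier → Carrier

  1≉0 : ¬ 1# ≈ 0#
  1≉0 1≈0 = proj₂ (tight 1# 0#) 1≈0 1#0

  inverse : ∀ {x} → ¬ x ≈ 0# → ∃[ y ] x * y ≈ 1#
  inverse {x} x≉0
    -- Tightness and excluded middle give apartness from zero, which inverts x - 0 rather than x.
    with y , _ , xy≈1 ← #⇒invertible (decidable-stable em (x≉0 ∘ proj₁ (tight x 0#))) =
    y , trans (*-congʳ (sym (x-0≈x x))) xy≈1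

  integral : ∀ {x y} → x * y ≈ 0# → x ≈ 0# ⊎ y ≈ 0#
  integral {x} {y} xy≈0 with em {P = x ≈ 0#}
  ... | yes x≈0 = inj₁ x≈0
  ... | no  x≉0 with z , xz≈1 ← inverse x≉0 = inj₂ (begin
    y              ≈⟨ *-identityˡ y ⟨
    1# * y         ≈⟨ *-congʳ xz≈1 ⟨
    x * z * y      ≈⟨ solve 3 (λ x y z → x :* z :* y := z :* (x :* y)) refl x y z ⟩
    z * (x * y)    ≈⟨ *-congˡ xy≈0 ⟩
    z * 0#         ≈⟨ zeroʳ z ⟩
    0#             ∎)

  open Domain em 1≉0 integral public

  zeros : (p : Vec Carrier n) → VecAll.All (_≈ 0#) p → ∀ x → poly p x ≈ 0#
  zeros []      []          x = refl
  zeros (a ∷ p) (a≈0 ∷ p≈0) x =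
    trans (+-cong a≈0 (trans (*-congˡ (zeros p p≈0 x)) (zeroʳ x))) (+-identityʳ 0#)

  -- Leading coefficients stand at the end of the vector, so the recursion on the tail meets the
  -- last nonzero coefficient `a` first, and the lower ones are then divided by it.
  normalise : (p : Vec Carrier n) →
              VecAll.All (_≈ 0#) p ⊎
              (∃[ a ] ¬ a ≈ 0# × (∃[ k ] k ℕ.< n ×
               (∃[ g ] ∀ x → poly p x ≈ a * monic {k} g x)))
  normalise [] = inj₁ []
  normalise (b ∷ p) with normalise p
  ... | inj₂ (a , a≉0 , k , k<n , g , p≈) with y , ay≈1 ← inverse a≉0 =
    inj₂ (a , a≉0 , suc k , s≤s k<n , y * b ∷ g , λ x → begin
      b + x * poly p x             ≈⟨ +-cong (sym (*-identityˡ b)) (*-congˡ (p≈ x)) ⟩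
      1# * b + x * (a * monic g x) ≈⟨ +-congʳ (*-congʳ ay≈1) ⟨
      a * y * b + x * (a * monic g x)
        ≈⟨ solve 5 (λ a y b x u → a :* y :* b :+ x :* (a :* u) :=
                                  a :* (y :* b :+ x :* u)) refl a y b x (monic g x) ⟩
      a * (y * b + x * monic g x)  ∎)
  ... | inj₁ p≈0 with em {P = b ≈ 0#}
  ...   | yes b≈0 = inj₁ (b≈0 ∷ p≈0)
  ...   | no  b≉0 = inj₂ (b , b≉0 , 0 , s≤s z≤n , [] , λ x → begin
      b + x * poly p x   ≈⟨ +-congˡ (*-congˡ (zeros p p≈0 x)) ⟩
      b + x * 0#         ≈⟨ solve 2 (λ b x → b :+ x :* con 0ℤ := b :* con 1ℤ) refl b x ⟩
      b * 1#             ∎)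

  -- Gaussian elimination.  Think of P d φ as φ being the image of some monic
  -- polynomial of degree d under a fixed linear map.  A pivot is only ever
  -- subtracted from rows of larger degree, so that these stay monic.
  module Elimination {p : Level} where
    Rows : Set (c ⊔ lsuc p)
    Rows = ℕ → (Carrier → Carrier) → Set p

    record Reducible (P : Rows) : Set (c ⊔ ℓ₁ ⊔ p) where
      field
        resp   : ∀ {d φ ψ} → (∀ x → φ x ≈ ψ x) → P d φ → P d ψ
        reduce : ∀ {d e φ ψ} → e ℕ.< d → ∀ a → P d φ → P e ψ → P d (λ x → φ x + a * ψ x)

    open Reducible

    Inhabited : ℕ → Rows → ℕ → Set _
    Inhabited k P d = ∃[ q ] P d (poly {k} q)

    -- A row whose constant coordinate has been cleared is x times a shorter row `φ`; passing to `φ`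
    -- drops that coordinate.
    tail : Rows → Rows
    tail P d φ = P d (λ x → x * φ x)

    tail-reducible : ∀ {P} → Reducible P → Reducible (tail P)
    tail-reducible R .resp φ≈ψ = resp R (λ x → *-congˡ (φ≈ψ x))
    tail-reducible R .reduce e<d a Pφ Pψ = resp R
      (λ x → solve 4 (λ x a u v → x :* u :+ a :* (x :* v) := x :* (u :+ a :* v)) refl x a _ _)
      (reduce R e<d a Pφ Pψ)

    -- The pivot is taken at the least degree where some row has a nonzero constant coefficient.
    -- Rows of smaller degree have nothing to clear, rows of larger degree are cleared by the pivot,
    -- and only the degree of the pivot is given up.
    clear : ∀ {P} → Reducible P → ∀ ds → AllPairs ℕ._<_ ds → All (Inhabited (suc k) P) ds →
            ∃[ es ] es ⊆ₗ ds × AllPairs ℕ._<_ es × All (Inhabited k (tail P)) es ×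
                    length ds ℕ.≤ suc (length es)
    clear R [] [] [] = [] , id , [] , [] , z≤n
    clear {k = k} {P = P} R (d ∷ ds) (d<ds ∷ sorted) ((b ∷ q , Pd) ∷ rows)
      with em {P = ∃[ a ] ∃[ p ] ¬ a ≈ 0# × P d (poly {suc k} (a ∷ p))}
    ... | yes (a , p , a≉0 , pivot) with y , ay≈1 ← inverse a≉0 =
      ds , xs⊆x∷xs ds d , sorted , All.zipWith subtract (d<ds , rows) , ℕ.≤-refl
      where
      subtract : ∀ {e} → d ℕ.< e × Inhabited (suc k) P e → Inhabited k (tail P) e
      subtract (d<e , b ∷ q , Pe)
        -- As `y` inverts `a`, the multiple `b * y` of the pivot has constant coefficient `b`.
        with r , q-byp≈r ← Degree<-linear (- (b * y)) (q , λ _ → refl) (p , λ _ → refl) =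
        r , resp R (λ x → begin
          (b + x * poly q x) + - (b * y) * (a + x * poly p x)
            ≈⟨ solve 6 (λ a y b x q p → (b :+ x :* q) :+ (:- (b :* y)) :* (a :+ x :* p) :=
                   b :* (con 1ℤ :- a :* y) :+ x :* (q :+ (:- (b :* y)) :* p))
                 refl a y b x (poly q x) (poly p x) ⟩
          b * (1# - a * y) + x * (poly q x + - (b * y) * poly p x)
            ≈⟨ +-cong (*-congˡ (+-congˡ (-‿cong ay≈1))) (*-congˡ (q-byp≈r x)) ⟩
          b * (1# - 1#) + x * poly r x
            ≈⟨ solve 2 (λ b u → b :* (con 1ℤ :- con 1ℤ) :+ u := u) refl b (x * poly r x) ⟩
          x * poly r x ∎)
          (reduce R d<e (- (b * y)) Pe pivot)
    ... | no no-pivot with es , es⊆ds , sorted′ , rows′ , len ← clear R ds sorted rows =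
      d ∷ es , ∷⁺ʳ d es⊆ds , All-resp-⊇ es⊆ds d<ds ∷ sorted′ , (q , resp R drop Pd) ∷ rows′ ,
      s≤s len
      where
      b≈0 : b ≈ 0#
      b≈0 = decidable-stable em (λ b≉0 → no-pivot (b , q , b≉0 , Pd))

      drop : ∀ x → b + x * poly q x ≈ x * poly q x
      drop x = trans (+-congʳ b≈0) (+-identityˡ _)

    -- Clearing each of the k coordinates costs at most one degree, so some degree survives to the
    -- end, where a row without coordinates is zero.
    dependent : ∀ {P} → Reducible P → ∀ ds → AllPairs ℕ._<_ ds → All (Inhabited k P) ds →
                k ℕ.< length ds → Any (λ d → P d (λ _ → 0#)) ds
    dependent {zero} R (d ∷ ds) _ (([] , Pd) ∷ _) _ = here Pd
    dependent {suc k} R ds sorted rows k<ds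
      with es , es⊆ds , sorted′ , rows′ , len ← clear R ds sorted rows =
      Any-resp-⊆ es⊆ds (Any.map (resp R zeroʳ)
        (dependent (tail-reducible R) es sorted′ rows′ (ℕ.≤-pred (ℕ.≤-trans k<ds len))))

  -- Arithmetic modulo a polynomial without roots, all lower degrees having roots.

  module Modulus
    (infinite : Infinite setoid)
    (f : Vec Carrier (suc n))
    (irreducible : ¬ (∃[ x ] monic f x ≈ 0#))
    (lower : ∀ {m} → m ℕ.< n → (g : Vec Carrier (suc m)) → ∃[ x ] monic g x ≈ 0#)
    where

    split : m ℕ.≤ n → (g : Vec Carrier m) → ∃[ rs ] ∀ x → monic g x ≈ (∏X-_ {m} rs) x
    split m≤n [] = [] , λ _ → refl
    split m<n g@(_ ∷ _) with r , gr≈0 ← lower m<n g with q , g≈ ← factor-root g gr≈0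
      with rs , q≈ ← split (ℕ.<⇒≤ m<n) q =
      r ∷ rs , λ x → trans (g≈ x) (*-congˡ (q≈ x))

    infix 4 f∣_

    -- The quotient must be a polynomial: as `f` vanishes nowhere, it divides every function
    -- pointwise.
    f∣_ : (Carrier → Carrier) → Set _
    f∣ φ = ∃[ q ] IsPoly q × ∀ x → φ x ≈ monic f x * q x

    f∣-resp : (∀ x → φ x ≈ ψ x) → f∣ φ → f∣ ψ
    f∣-resp φ≈ψ (q , q-poly , φ≈) = q , q-poly , λ x → trans (sym (φ≈ψ x)) (φ≈ x)

    f∣0 : f∣ (λ _ → 0#)
    f∣0 = (λ _ → 0#) , IsPoly-const 0# , λ x → sym (zeroʳ _)

    f∣f : f∣ monic f
    f∣f = (λ _ → 1#) , IsPoly-const 1# , λ x → sym (*-identityʳ _)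

    f∣-+ : f∣ φ → f∣ ψ → f∣ (λ x → φ x + ψ x)
    f∣-+ (q , q-poly , φ≈) (r , r-poly , ψ≈) =
      (λ x → q x + r x) , IsPoly-+ q-poly r-poly ,
      λ x → trans (+-cong (φ≈ x) (ψ≈ x)) (sym (distribˡ _ _ _))

    f∣-* : IsPoly ψ → f∣ φ → f∣ (λ x → ψ x * φ x)
    f∣-* {ψ = ψ} ψ-poly (q , q-poly , φ≈) =
      (λ x → ψ x * q x) , IsPoly-* ψ-poly q-poly ,
      λ x → trans (*-congˡ (φ≈ x))
              (solve 3 (λ u f q → u :* (f :* q) := f :* (u :* q)) refl (ψ x) (monic f x) (q x))

    f∣-neg : f∣ φ → f∣ (λ x → - φ x)
    f∣-neg f∣φ = f∣-resp (λ x → solve 1 (λ u → (:- con 1ℤ) :* u := :- u) refl _)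
                   (f∣-* (IsPoly-const (- 1#)) f∣φ)

    f∣-- : f∣ φ → f∣ ψ → f∣ (λ x → φ x - ψ x)
    f∣-- f∣φ f∣ψ = f∣-+ f∣φ (f∣-neg f∣ψ)

    -- Horner's scheme with a reduction at each step: if `r` is a remainder of `p`, then a + x r has
    -- one coefficient too many, and subtracting a constant multiple of `f` removes it.
    remainder : IsPoly φ → ∃[ r ] f∣ (λ x → φ x - poly {suc n} r x)
    remainder {φ = φ} (_ , p , φ≈p) =
      let r , f∣p-r = go p in
      r , f∣-resp (λ x → +-congʳ (sym (φ≈p x))) f∣p-r
      where
      go : (p : Vec Carrier m) → ∃[ r ] f∣ (λ x → poly p x - poly {suc n} r x)
      go [] with r , 0≈r ← Degree<-zero (suc n) =
        r , f∣-resp (λ x → sym (trans (+-congˡ (-‿cong (sym (0≈r x)))) (-‿inverseʳ 0#))) f∣0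
      go (a ∷ p) with r , f∣p-r ← go p with u , s , a+xr-uf≈s ← divide-leading (a ∷ r) f =
        s , f∣-resp (λ x → begin
          x * (poly p x - poly r x) + u * monic f x
            ≈⟨ solve 6 (λ a x p r u f → x :* (p :- r) :+ u :* f :=
                   (a :+ x :* p) :- ((a :+ x :* r) :- u :* f))
                 refl a x (poly p x) (poly r x) u (monic f x) ⟩
          (a + x * poly p x) - ((a + x * poly r x) - u * monic f x)
            ≈⟨ +-congˡ (-‿cong (a+xr-uf≈s x)) ⟩
          (a + x * poly p x) - poly s x ∎)
          (f∣-+ (f∣-* (IsPoly-resp (λ x → *-identityʳ x) (IsPoly-X* (IsPoly-const 1#))) f∣p-r)
                (f∣-* (IsPoly-const u) f∣f))

    -- The value f(a) is invertible, and f(a) φ = f φ - (f - f(a)) φ. Since f - f(a) is a multiple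
    -- of x - a, both terms on the right are multiples of `f`.
    cancel-linear : ∀ a → IsPoly φ → f∣ (λ x → (x - a) * φ x) → f∣ φ
    cancel-linear {φ = φ} a φ-poly (q , q-poly , eq)
      with g , f≈ ← factor f a
      with y , fa*y≈1 ← inverse (λ fa≈0 → irreducible (a , fa≈0)) =
      (λ x → y * (φ x - monic g x * q x)) ,
      IsPoly-* (IsPoly-const y) (IsPoly-+ φ-poly (IsPoly-neg (IsPoly-* (IsPoly-monic g) q-poly))) ,
      λ x → begin
        φ x
          ≈⟨ *-identityˡ _ ⟨
        1# * φ x
          ≈⟨ *-congʳ fa*y≈1 ⟨
        monic f a * y * φ x
          ≈⟨ solve 4 (λ A y u F → A :* y :* u := y :* (F :* u :- (F :- A) :* u))
               refl (monic f a) y (φ x) (monic f x) ⟩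
        y * (monic f x * φ x - (monic f x - monic f a) * φ x)
          ≈⟨ *-congˡ (+-congˡ (-‿cong (*-congʳ (f≈ x)))) ⟩
        y * (monic f x * φ x - (x - a) * monic g x * φ x)
          ≈⟨ solve 5 (λ y F u d g → y :* (F :* u :- d :* g :* u) := y :* (F :* u :- g :* (d :* u)))
               refl y (monic f x) (φ x) (x - a) (monic g x) ⟩
        y * (monic f x * φ x - monic g x * ((x - a) * φ x))
          ≈⟨ *-congˡ (+-congˡ (-‿cong (*-congˡ (eq x)))) ⟩
        y * (monic f x * φ x - monic g x * (monic f x * q x))
          ≈⟨ solve 5 (λ y F u g q → y :* (F :* u :- g :* (F :* q)) := F :* (y :* (u :- g :* q)))
               refl y (monic f x) (φ x) (monic g x) (q x) ⟩
        monic f x * (y * (φ x - monic g x * q x)) ∎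

    cancel-∏ : (rs : Vec Carrier m) → IsPoly φ → f∣ (λ x → (∏X- rs) x * φ x) → f∣ φ
    cancel-∏ []       φ-poly f∣φ = f∣-resp (λ x → *-identityˡ _) f∣φ
    cancel-∏ (r ∷ rs) φ-poly f∣φ =
      cancel-∏ rs φ-poly (cancel-linear r
        (IsPoly-* (_ , Monic⇒Degree< (monic-∏ rs)) φ-poly)
        (f∣-resp (λ x → *-assoc _ _ _) f∣φ))

    -- If f · a · g were constantly one with `g` monic, then f g - 1/a would be monic of positive
    -- degree and vanish everywhere, so that listing its roots would list the infinite field.
    f∤1 : ¬ f∣ (λ _ → 1#)
    f∤1 (q , (k , p , q≈p) , 1≈fq) with normalise p
    ... | inj₁ p≈0 =
      1≉0 (trans (1≈fq 0#) (trans (*-congˡ (trans (q≈p 0#) (zeros p p≈0 0#))) (zeroʳ _)))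
    ... | inj₂ (a , a≉0 , k , _ , g , p≈ag) with y , ay≈1 ← inverse a≉0 =
      let fg-y , fg-y≈ = Monic-+ (Monic-* (f , λ _ → refl) (g , λ _ → refl))
                                 (Degree<-≤ (s≤s z≤n) (Degree<-const (- y)))
          rs , all = roots fg-y
      in infinite (rs , λ x → all (trans (sym (fg-y≈ x)) (fg≈y y ay≈1 x)))
      where
      Degree<-const : ∀ b → Degree< 1 (λ _ → b)
      Degree<-const b = proj₂ (IsPoly-const b)

      fg≈y : ∀ y → a * y ≈ 1# → ∀ x → monic f x * monic g x - y ≈ 0#
      fg≈y y ay≈1 x = begin
        monic f x * monic g x - y
          ≈⟨ +-congʳ (*-identityˡ _) ⟨
        1# * (monic f x * monic g x) - y
          ≈⟨ +-congʳ (*-congʳ ay≈1) ⟨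
        a * y * (monic f x * monic g x) - y
          ≈⟨ solve 4 (λ a y f g → a :* y :* (f :* g) :- y := y :* (f :* (a :* g) :- con 1ℤ))
               refl a y (monic f x) (monic g x) ⟩
        y * (monic f x * (a * monic g x) - 1#)
          ≈⟨ *-congˡ (+-congʳ (trans (1≈fq x) (*-congˡ (trans (q≈p x) (p≈ag x))))) ⟨
        y * (1# - 1#)
          ≈⟨ solve 1 (λ y → y :* (con 1ℤ :- con 1ℤ) := con 0ℤ) refl y ⟩
        0# ∎

    -- A nonzero `p` has degree below that of `f`, so it is a unit times linear factors, which
    -- cancel one by one.
    cancel-poly : (p : Vec Carrier (suc n)) → IsPoly φ → f∣ (λ x → poly p x * φ x) →
                  VecAll.All (_≈ 0#) p ⊎ f∣ φ
    cancel-poly {φ = φ} p φ-poly f∣pφ with normalise p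
    ... | inj₁ p≈0 = inj₁ p≈0
    ... | inj₂ (a , a≉0 , k , s≤s k≤n , g , p≈ag)
      with y , ay≈1 ← inverse a≉0 | rs , g≈∏ ← split k≤n g =
      inj₂ (cancel-∏ rs φ-poly (f∣-resp (λ x → begin
        y * (poly p x * φ x)             ≈⟨ *-congˡ (*-congʳ (p≈ag x)) ⟩
        y * (a * monic g x * φ x)
          ≈⟨ solve 4 (λ y a g u → y :* (a :* g :* u) := a :* y :* (g :* u))
               refl y a (monic g x) (φ x) ⟩
        a * y * (monic g x * φ x)        ≈⟨ *-cong ay≈1 (*-congʳ (g≈∏ x)) ⟩
        1# * ((∏X- rs) x * φ x)          ≈⟨ *-identityˡ _ ⟩
        (∏X- rs) x * φ x                 ∎)
        (f∣-* (IsPoly-const y) f∣pφ)))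

    -- This makes coordinates modulo `f` unique. Cancelling a nonzero `p` from p · 1 would leave `f`
    -- dividing one.
    f∣poly⇒zero : (p : Vec Carrier (suc n)) → f∣ poly p → VecAll.All (_≈ 0#) p
    f∣poly⇒zero p f∣p
      with cancel-poly p (IsPoly-const 1#) (f∣-resp (λ x → sym (*-identityʳ _)) f∣p)
    ... | inj₁ p≈0 = p≈0
    ... | inj₂ f∣1 = contradiction f∣1 f∤1

    -- Modulo `f` the factor `φ` may be replaced by its remainder, which is zero or can be
    -- cancelled.
    prime : IsPoly φ → IsPoly ψ → f∣ (λ x → φ x * ψ x) → f∣ φ ⊎ f∣ ψ
    prime {φ = φ} {ψ = ψ} φ-poly ψ-poly f∣φψ =
      let r , f∣φ-r = remainder φ-poly in
      Sum.map₁
        (λ r≈0 → f∣-resp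
          (λ x → trans (+-congˡ (-‿cong (zeros r r≈0 x)))
                       (solve 1 (λ u → u :- con 0ℤ := u) refl (φ x)))
          f∣φ-r)
        (cancel-poly r ψ-poly (f∣-resp
          (λ x → solve 3 (λ u v r → u :* v :- v :* (u :- r) := r :* v) refl
                   (φ x) (ψ x) (poly r x))
          (f∣-- f∣φψ (f∣-* ψ-poly f∣φ-r))))

    -- The quotient ring K[X]/(f).

    infix 4 _≡f_
    _≡f_ : ∃ IsPoly → ∃ IsPoly → Set _
    (φ , _) ≡f (ψ , _) = f∣ (λ x → φ x - ψ x)

    ≈⇒f∣- : (∀ x → φ x ≈ ψ x) → f∣ (λ x → φ x - ψ x)
    ≈⇒f∣- φ≈ψ = f∣-resp (λ x → sym (trans (+-congʳ (φ≈ψ x)) (-‿inverseʳ _))) f∣0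

    quotient : CommutativeRing (c ⊔ ℓ₁) (c ⊔ ℓ₁)
    quotient = record
      { Carrier = ∃ IsPoly
      ; _≈_     = _≡f_
      ; _+_     = λ (φ , p) (ψ , q) → (λ x → φ x + ψ x) , IsPoly-+ p q
      ; _*_     = λ (φ , p) (ψ , q) → (λ x → φ x * ψ x) , IsPoly-* p q
      ; -_      = λ (φ , p) → (λ x → - φ x) , IsPoly-neg p
      ; 0#      = _ , IsPoly-const 0#
      ; 1#      = _ , IsPoly-const 1#
      ; isCommutativeRing = record
        { isRing = record
          { +-isAbelianGroup = record
            { isGroup = record
              { isMonoid = record
                { isSemigroup = record
                  { isMagma = record
                    { isEquivalence = record
                      { refl  = ≈⇒f∣- (λ _ → refl)
                      ; sym   = λ d → f∣-resp
                          (λ x → solve 2 (λ u v → :- (u :- v) := v :- u) refl _ _) (f∣-neg d)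
                      ; trans = λ d e → f∣-resp
                          (λ x → solve 3 (λ u v w → (u :- v) :+ (v :- w) := u :- w) refl _ _ _)
                          (f∣-+ d e)
                      }
                    ; ∙-cong = λ d e → f∣-resp
                        (λ x → solve 4 (λ u v s t → (u :- v) :+ (s :- t) := (u :+ s) :- (v :+ t))
                                 refl _ _ _ _)
                        (f∣-+ d e)
                    }
                  ; assoc = λ _ _ _ → ≈⇒f∣- (λ _ → +-assoc _ _ _)
                  }
                ; identity = (λ _ → ≈⇒f∣- (λ _ → +-identityˡ _)) , (λ _ → ≈⇒f∣- (λ _ → +-identityʳ _))
                }
              ; inverse = (λ _ → ≈⇒f∣- (λ _ → -‿inverseˡ _)) , (λ _ → ≈⇒f∣- (λ _ → -‿inverseʳ _))
              ; ⁻¹-cong = λ d → f∣-resp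
                  (λ x → solve 2 (λ u v → :- (u :- v) := :- u :- :- v) refl _ _) (f∣-neg d)
              }
            ; comm = λ _ _ → ≈⇒f∣- (λ _ → +-comm _ _)
            }
          ; *-cong = λ {(_ , _)} {(_ , q)} {(_ , r)} {(_ , _)} d e → f∣-resp
              (λ x → solve 4 (λ u v s t → s :* (u :- v) :+ v :* (s :- t) := u :* s :- v :* t)
                       refl _ _ _ _)
              (f∣-+ (f∣-* r d) (f∣-* q e))
          ; *-assoc    = λ _ _ _ → ≈⇒f∣- (λ _ → *-assoc _ _ _)
          ; *-identity = (λ _ → ≈⇒f∣- (λ _ → *-identityˡ _)) , (λ _ → ≈⇒f∣- (λ _ → *-identityʳ _))
          ; distrib    = (λ _ _ _ → ≈⇒f∣- (λ _ → distribˡ _ _ _)) ,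
                         (λ _ _ _ → ≈⇒f∣- (λ _ → distribʳ _ _ _))
          }
        ; *-comm = λ _ _ → ≈⇒f∣- (λ _ → *-comm _ _)
        }
      }

    IsPoly-horner : ∀ {b} (g : Vec Carrier m) → IsPoly φ → IsPoly (λ x → horner b g (φ x))
    IsPoly-horner []      φ-poly = IsPoly-const _
    IsPoly-horner (a ∷ g) φ-poly =
      IsPoly-+ (IsPoly-const a) (IsPoly-* φ-poly (IsPoly-horner g φ-poly))

    module Quotient where
      open CommutativeRing quotient using () renaming
        (Carrier to L; _≈_ to _≈ᴸ_; setoid to setoidᴸ; 0# to 0ᴸ; 1# to 1ᴸ; _*_ to _*ᴸ_)
      module L[X] = Polynomials quotient

      f∣-0 : f∣ φ → f∣ (λ x → φ x - 0#)
      f∣-0 = f∣-resp (λ x → solve 1 (λ u → u := u :- con 0ℤ) refl _)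

      0-f∣ : f∣ (λ x → φ x - 0#) → f∣ φ
      0-f∣ = f∣-resp (λ x → solve 1 (λ u → u :- con 0ℤ := u) refl _)

      1≉0ᴸ : ¬ 1ᴸ ≈ᴸ 0ᴸ
      1≉0ᴸ = f∤1 ∘ 0-f∣

      integralᴸ : ∀ {u v} → u *ᴸ v ≈ᴸ 0ᴸ → u ≈ᴸ 0ᴸ ⊎ v ≈ᴸ 0ᴸ
      integralᴸ {_ , φ-poly} {_ , ψ-poly} uv≈0 =
        Sum.map f∣-0 f∣-0 (prime φ-poly ψ-poly (0-f∣ uv≈0))

      constᴸ : Carrier → L
      constᴸ a = _ , IsPoly-const a

      -- Evaluation at a residue class is composition with a representative, so `f` dividing g(φ)
      -- means that the class of `φ` is a root of `g`.
      monicᴸ : (g : Vec Carrier m) (u : L) (x : Carrier) →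
               proj₁ (L[X].monic (Vec.map constᴸ g) u) x ≈ monic g (proj₁ u x)
      monicᴸ []      u x = refl
      monicᴸ (a ∷ g) u x = +-congˡ (*-congˡ (monicᴸ g u x))

      open L[X].Domain em 1≉0ᴸ (λ {u} {v} → integralᴸ {u} {v})
        renaming (roots to rootsᴸ) using ()
      open SetoidMembership setoid using () renaming (_∈_ to _∈ₗ_)

      -- R lists the coordinates of the finitely many roots of g in K[X]/(f).
      coordinates : (g : Vec Carrier m) →
        ∃[ R ] ∀ {p : Vec Carrier (suc n)} → f∣ (λ x → monic g (poly p x)) →
               ∀ {a} → a ∈ₗ toList p → a ∈ₗ R
      coordinates g =
        let rs , all = rootsᴸ (Vec.map constᴸ g) in
        List.concatMap coords rs , λ {p} f∣gp → collect p rs (all {_ , IsPoly-poly p}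
          (f∣-0 (f∣-resp (λ x → sym (monicᴸ g (_ , IsPoly-poly p) x)) f∣gp)))
        where
        open SetoidMembership setoidᴸ using () renaming (_∈_ to _∈ᴸ_)

        coords : L → List Carrier
        coords (_ , φ-poly) = toList (proj₁ (remainder φ-poly))

        agree : (p r : Vec Carrier m) →
                VecAll.All (_≈ 0#) (Vec.zipWith _+_ p (Vec.map (-_) r)) →
                ∀ {a} → a ∈ₗ toList p → a ∈ₗ toList r
        agree (b ∷ p) (b′ ∷ r) (b-b′≈0 ∷ _) (here a≈b) = here (trans a≈b (x-y≈0⇒x≈y b-b′≈0))
        agree (b ∷ p) (b′ ∷ r) (_ ∷ rest)   (there a∈) = there (agree p r rest a∈)

        poly-neg : (r : Vec Carrier m) → ∀ x → poly (Vec.map (-_) r) x ≈ - poly r x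
        poly-neg []      x = solve 0 (con 0ℤ := :- con 0ℤ) refl
        poly-neg (a ∷ r) x = trans (+-congˡ (*-congˡ (poly-neg r x)))
          (solve 3 (λ a x u → :- a :+ x :* (:- u) := :- (a :+ x :* u)) refl a x (poly r x))

        -- The difference of `p` and `r` is a multiple of `f` of degree below that of `f`, so its
        -- coefficients vanish.
        congruent : (p r : Vec Carrier (suc n)) → f∣ (λ x → poly p x - φ x) →
                    f∣ (λ x → φ x - poly r x) →
                    ∀ {a} → a ∈ₗ toList p → a ∈ₗ toList r
        congruent {φ = φ} p r p≡φ φ≡r = agree p r (f∣poly⇒zero _ (f∣-resp (λ x → begin
          (poly p x - φ x) + (φ x - poly r x)
            ≈⟨ solve 3 (λ p u r → (p :- u) :+ (u :- r) := p :+ :- r) refl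
                 (poly p x) (φ x) (poly r x) ⟩
          poly p x + - poly r x
            ≈⟨ +-congˡ (poly-neg r x) ⟨
          poly p x + poly (Vec.map (-_) r) x
            ≈⟨ horner-+ 0# p (Vec.map (-_) r) x ⟩
          poly (Vec.zipWith _+_ p (Vec.map (-_) r)) x ∎)
          (f∣-+ p≡φ φ≡r)))

        collect : (p : Vec Carrier (suc n)) → ∀ rs → (_ , IsPoly-poly p) ∈ᴸ rs →
                  ∀ {a} → a ∈ₗ toList p → a ∈ₗ List.concatMap coords rs
        collect p ((φ , φ-poly) ∷ rs) (here p≡φ) a∈p =
          let r , f∣φ-r = remainder φ-poly in
          Membership.∈-++⁺ˡ setoid (congruent {φ = φ} p r p≡φ f∣φ-r a∈p)
        collect p (u ∷ rs) (there p∈rs) a∈p =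
          Membership.∈-++⁺ʳ setoid (coords u) (collect p rs p∈rs a∈p)

    -- The residues of the powers of `φ` with exponents 0 to n + 1 are n + 2 vectors with n + 1
    -- coordinates. Elimination by increasing degree keeps every combination monic, and one of them
    -- has residue zero.
    relation : IsPoly φ → ∃[ m ] m ℕ.≤ suc n × ∃[ g ] f∣ (λ x → monic {m} g (φ x))
    relation {φ = φ} φ-poly =
      let d , d∈ , g , f∣gφ = find (dependent reducible (upTo (suc (suc n)))
             (AllPairs.applyUpTo⁺₁ id _ (λ i<j _ → i<j))
             (All.universal (λ d → monic∘ d) _)
             (ℕ.≤-reflexive (≡.sym (List.length-upTo _)))) in
      d , ℕ.≤-pred (∈-upTo⁻ d∈) , g , f∣-resp (λ x → solve 1 (λ u → u :- con 0ℤ := u) refl _) f∣gφ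
      where
      open Elimination
      Residue : Rows
      Residue d ψ = ∃[ g ] f∣ (λ x → monic {d} g (φ x) - ψ x)

      monic∘ : ∀ d → Inhabited (suc n) Residue d
      monic∘ d =
        -- With zero lower coefficients, `g` is the power of degree `d`.
        let g = Vec.replicate d 0#
            r , f∣g-r = remainder (IsPoly-horner g φ-poly)
        in r , g , f∣g-r

      reducible : Reducible Residue
      reducible = record
        { resp   = λ φ≈ψ (g , d) → g , f∣-resp (λ x → +-congˡ (-‿cong (φ≈ψ x))) d
        ; reduce = λ { {φ = u} {ψ = v} e<d a (g , d) (h , e) →
            let g+ah , ≈g+ah = Monic-+ (g , λ _ → refl)
                  (Degree<-scale a (Degree<-≤ e<d (Monic⇒Degree< (h , λ _ → refl))))
            in g+ah , f∣-resp (λ x → trans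
                 (solve 5 (λ a g h u v → (g :- u) :+ a :* (h :- v) :=
                                         (g :+ a :* h) :- (u :+ a :* v))
                    refl a (monic g (φ x)) (monic h (φ x)) (u x) (v x))
                 (+-congʳ (≈g+ah (φ x))))
                 (f∣-+ d (f∣-* (IsPoly-const a) e)) }
        }

    -- As `f` is prime, it divides one of the factors φ - r; the empty product is excluded because
    -- `f` does not divide one.
    divides-factor : (rs : Vec Carrier m) → IsPoly φ → f∣ (λ x → (∏X- rs) (φ x)) →
                     ∃[ r ] f∣ (λ x → φ x - r)
    divides-factor []       φ-poly f∣1 = contradiction f∣1 f∤1
    divides-factor {φ = φ} (r ∷ rs) φ-poly f∣∏ =
      let g , ∏≈g = monic-∏ rs in
      Sum.[ (λ f∣φ-r → r , f∣φ-r) , divides-factor rs φ-poly ]′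
        (prime (IsPoly-+ φ-poly (IsPoly-const (- r)))
               (IsPoly-resp (λ x → sym (∏≈g (φ x))) (IsPoly-horner g φ-poly)) f∣∏)

-- Independence and dimension in a pregeometry.

module Closure (em : ∀ {ℓ} → ExcludedMiddle ℓ) (S : Setoid c ℓ) (P : Pregeometry S) where
  open Setoid S
  open Pregeometry P
  open SetoidMembership S using () renaming (_∈_ to _∈ₗ_)

  private
    variable
      m n : ℕ
      a b : Carrier
      xs ys zs : List Carrier
      A B : Subset S

  ⟨_⟩ : List Carrier → Subset S
  ⟨ xs ⟩ = ⟪_⟫ S xs

  ∈-cons⁻ : a ∈ₗ b ∷ xs → a ≈ b ⊎ a ∈ₗ xs
  ∈-cons⁻ (here a≈b)  = inj₁ a≈b
  ∈-cons⁻ (there a∈xs) = inj₂ a∈xs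

  cl-⊆ : A ⊆ cl B → cl A ⊆ cl B
  cl-⊆ A⊆clB = idempotent _ ∘ monotone A⊆clB

  All⇒⊆ : All (cl A) xs → ⟨ xs ⟩ ⊆ cl A
  All⇒⊆ (x∈ ∷ _)   (here y≈x)  = cl-resp-≈ _ (sym y≈x) x∈
  All⇒⊆ (_ ∷ xs⊆) (there y∈xs) = All⇒⊆ xs⊆ y∈xs

  cl-++ : ⟨ xs ⟩ ⊆ cl A → ⟨ ys ⟩ ⊆ cl A → ⟨ xs ++ ys ⟩ ⊆ cl A
  cl-++ {xs = xs} xs⊆ ys⊆ = Sum.[ xs⊆ , ys⊆ ]′ ∘ Membership.∈-++⁻ S xs

  cl-weakenʳ : ∀ xs → cl ⟨ ys ⟩ ⊆ cl ⟨ xs ++ ys ⟩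
  cl-weakenʳ xs = monotone (Membership.∈-++⁺ʳ S xs)

  finite-support : A ⊆ cl B → ∀ xs → ⟨ xs ⟩ ⊆ A → ∃[ ys ] All B ys × ⟨ xs ⟩ ⊆ cl ⟨ ys ⟩
  finite-support A⊆clB []       _    = [] , [] , λ ()
  finite-support A⊆clB (x ∷ xs) xs⊆A
    with ys , ys⊆B , x∈ ← finitary _ (A⊆clB (xs⊆A (here refl)))
       | zs , zs⊆B , xs⊆ ← finite-support A⊆clB xs (xs⊆A ∘ there) =
    ys ++ zs , All.++⁺ ys⊆B zs⊆B ,
    Sum.[ (λ y≈x → cl-resp-≈ _ (sym y≈x) (monotone (Membership.∈-++⁺ˡ S) x∈))
        , cl-weakenʳ ys ∘ xs⊆ ]′ ∘ ∈-cons⁻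

  -- A finite spanning set would lie in the closure of finitely many elements of
  -- the basis, which by independence are the whole basis.
  infinite-dimensional : Infinite S → HasDimension S → ∀ xs → ∃[ b ] b ∉ cl ⟨ xs ⟩
  infinite-dimensional infinite (B , (independent , spanning) , B↔S) xs =
    decidable-stable em λ none →
      let spans b = decidable-stable em (λ b∉ → none (b , b∉))
          ys , ys⊆B , xs⊆ = finite-support {A = λ _ → ⊤} (λ _ → spanning _) xs _
      -- The basis is in bijection with the field, so `ys` would yield a list of the whole field.
      in infinite (enumerate ys⊆B , λ s →
           let (b , b∈B) , b↦s = strictlySurjective s
           in enumerated ys⊆B b∈B (basis-listed ys⊆B (cl-⊆ xs⊆ (spans b)) b∈B) b↦s)
    where
    open Bijection B↔S using (to; cong; strictlySurjective)

    basis-listed : All B ys → b ∈ cl ⟨ ys ⟩ → b ∈ B → b ∈ₗ ys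
    basis-listed {ys = ys} {b = b} ys⊆B b∈cl b∈B = decidable-stable em λ b∉ys →
      independent b∈B (cl-⊆ (All⇒⊆ (All.tabulate λ {y} y∈ys →
        extensive _ (All.lookup ys⊆B y∈ys ,
                     λ y≈b → b∉ys (Membership.∈-resp-≈ S y≈b (∈⇒∈ₗ y∈ys))))) b∈cl)
      where
      ∈⇒∈ₗ : ∀ {y} {ys} → y ∈≡ ys → y ∈ₗ ys
      ∈⇒∈ₗ = Any.map reflexive

    enumerate : All B ys → List Carrier
    enumerate []                         = []
    enumerate {ys = y ∷ _} (y∈B ∷ ys⊆B) = to (y , y∈B) ∷ enumerate ys⊆B

    enumerated : (ys⊆B : All B ys) → ∀ {b s} (b∈B : b ∈ B) → b ∈ₗ ys → to (b , b∈B) ≈ s →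
                 s ∈ₗ enumerate ys⊆B
    enumerated (_ ∷ _)    b∈B (here b≈y) b↦s = here (trans (sym b↦s) (cong b≈y))
    enumerated (_ ∷ ys⊆B) b∈B (there b∈) b↦s = there (enumerated ys⊆B b∈B b∈ b↦s)

  -- Independence in sequential form, which suits exchanging or moving one entry at a time.
  IndependentOver : List Carrier → Vec Carrier n → Set (c ⊔ ℓ)
  IndependentOver xs []       = ⊤
  IndependentOver xs (t ∷ ts) = t ∉ cl ⟨ xs ⟩ × IndependentOver (t ∷ xs) ts

  independent-antitone : (ts : Vec Carrier n) → ⟨ xs ⟩ ⊆ ⟨ ys ⟩ →
                         IndependentOver ys ts → IndependentOver xs ts
  independent-antitone []       xs⊆ys _         = tt
  independent-antitone (t ∷ ts) xs⊆ys (t∉ , ind) =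
    t∉ ∘ monotone xs⊆ys ,
    independent-antitone ts (Sum.[ here , there ∘ xs⊆ys ]′ ∘ ∈-cons⁻) ind

  exchange-∷ : a ∈ cl ⟨ b ∷ xs ⟩ → a ∉ cl ⟨ xs ⟩ → b ∈ cl ⟨ a ∷ xs ⟩
  exchange-∷ a∈ a∉ = monotone Sum.[ there , here ]′
    (exchange _ (monotone (Sum.swap ∘ ∈-cons⁻) a∈) a∉)

  -- Entries are removed from the front until `a` leaves the closure. The entry whose removal causes
  -- this is exchanged for `a`, and all others are kept.
  replace : ∀ cs → a ∈ cl ⟨ cs ++ xs ⟩ → a ∉ cl ⟨ xs ⟩ →
            ∃[ ds ] length cs ≡ suc (length ds) × ⟨ cs ⟩ ⊆ cl ⟨ ds ++ a ∷ xs ⟩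
  replace [] a∈ a∉ = contradiction a∈ a∉
  replace {a = a} {xs = xs} (c ∷ cs) a∈ a∉ with em {P = a ∈ cl ⟨ cs ++ xs ⟩}
  ... | yes a∈′ with ds , len , cs⊆ ← replace cs a∈′ a∉ =
    c ∷ ds , ≡.cong suc len ,
    Sum.[ extensive _ ∘ here , monotone there ∘ cs⊆ ]′ ∘ ∈-cons⁻
  ... | no  a∉′ = cs , ≡.refl , Sum.[ c∈ , extensive _ ∘ Membership.∈-++⁺ˡ S ]′ ∘ ∈-cons⁻
    where
    c∈ : ∀ {d} → d ≈ c → d ∈ cl ⟨ cs ++ a ∷ xs ⟩
    c∈ d≈c = cl-resp-≈ _ (sym d≈c) (monotone
      (Sum.[ Membership.∈-++⁺ʳ S cs ∘ here
           , Sum.[ Membership.∈-++⁺ˡ S , Membership.∈-++⁺ʳ S cs ∘ there ]′ ∘ Membership.∈-++⁻ S cs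
           ]′ ∘ ∈-cons⁻)
      (exchange-∷ a∈ a∉′))

  -- Each entry of `ts` takes the place of one entry of `cs` and then joins the base `xs`.
  steinitz : ∀ cs (ts : Vec Carrier n) → IndependentOver xs ts →
             ⟨ toList ts ⟩ ⊆ cl ⟨ cs ++ xs ⟩ → n ℕ.≤ length cs
  steinitz cs []       _         _   = z≤n
  steinitz cs (t ∷ ts) (t∉ , ind) ts⊆ with ds , len , cs⊆ ← replace cs (ts⊆ (here refl)) t∉ =
    ≡.subst (_ ℕ.≤_) (≡.sym len) (s≤s (steinitz ds ts ind
      (cl-⊆ (cl-++ cs⊆ (extensive _ ∘ Membership.∈-++⁺ʳ S ds ∘ there)) ∘ ts⊆ ∘ there)))

  -- The first entry that lies in the closure of `xs` and its predecessors can be discarded without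
  -- loss.
  independent-or-redundant : ∀ xs (cs : Vec Carrier n) → IndependentOver xs cs ⊎
    (∃[ ds ] length ds ℕ.< n × ⟨ toList cs ⟩ ⊆ cl ⟨ ds ++ xs ⟩)
  independent-or-redundant xs [] = inj₁ tt
  independent-or-redundant xs (c ∷ cs) with em {P = c ∈ cl ⟨ xs ⟩}
  ... | yes c∈ = inj₂ (toList cs , ℕ.≤-reflexive (≡.cong suc (Vec.length-toList cs)) ,
    Sum.[ (λ d≈c → cl-resp-≈ _ (sym d≈c) (cl-weakenʳ (toList cs) c∈))
        , extensive _ ∘ Membership.∈-++⁺ˡ S ]′ ∘ ∈-cons⁻)
  ... | no c∉ with independent-or-redundant (c ∷ xs) cs
  ...   | inj₁ ind = inj₁ (c∉ , ind)
  ...   | inj₂ (ds , ds<n , cs⊆) = inj₂ (c ∷ ds , s≤s ds<n ,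
    Sum.[ extensive _ ∘ here , monotone move ∘ cs⊆ ]′ ∘ ∈-cons⁻)
    where
    move : ⟨ ds ++ c ∷ xs ⟩ ⊆ ⟨ c ∷ ds ++ xs ⟩
    move = Sum.[ there ∘ Membership.∈-++⁺ˡ S
               , Sum.[ here , there ∘ Membership.∈-++⁺ʳ S ds ]′ ∘ ∈-cons⁻
               ]′ ∘ Membership.∈-++⁻ S ds

  -- A redundant entry of `cs` would leave fewer than n elements spanning n independent ones.
  spanning⇒independent : (ts cs : Vec Carrier n) → IndependentOver xs ts →
                         ⟨ toList ts ⟩ ⊆ cl ⟨ toList cs ++ xs ⟩ → IndependentOver xs cs
  spanning⇒independent {xs = xs} ts cs ind ts⊆ with independent-or-redundant xs cs
  ... | inj₁ ind′ = ind′
  ... | inj₂ (ds , ds<n , cs⊆) = contradiction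
    (steinitz ds ts ind (cl-⊆ (cl-++ cs⊆ (extensive _ ∘ Membership.∈-++⁺ʳ S ds)) ∘ ts⊆))
    (ℕ.<⇒≱ ds<n)

  independent-tuple : (∀ xs → ∃[ b ] b ∉ cl ⟨ xs ⟩) → ∀ n xs →
                      ∃[ ts ] IndependentOver {n} xs ts
  independent-tuple generic zero    xs = [] , tt
  independent-tuple generic (suc n) xs with b , b∉ ← generic xs
    with ts , ind ← independent-tuple generic n (b ∷ xs) = b ∷ ts , b∉ , ind

-- Automorphisms of the homogeneous field.

module HomogeneousField
  (em : ∀ {ℓ} → ExcludedMiddle ℓ) (K : HeytingField c ℓ₁ ℓ₂) (H : ωHomogeneousPregeometry K)
  where
  open HeytingField K using (heytingCommutativeRing)
  open HeytingCommutativeRing heytingCommutativeRing using (commutativeRing)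
  open CommutativeRing commutativeRing
  open RingSolver commutativeRing
  open Polynomials commutativeRing
  open Field em K
  open ωHomogeneousPregeometry H
  open Closure em setoid pregeometry
  open Automorphism using (⟦_⟧; Fixes; image)
  open import Relation.Binary.Reasoning.Setoid setoid
  open SetoidMembership setoid using () renaming (_∈_ to _∈ₗ_)

  private
    variable
      m n : ℕ
      xs : List Carrier

  generic : ∀ xs → ∃[ b ] b ∉ cl ⟨ xs ⟩
  generic = infinite-dimensional infinite dimension

  module Action (σ : Automorphism K) where
    open Automorphism σ using (isRingIsomorphism) renaming (⟦_⟧ to act) public
    open RingMorphisms.IsRingIsomorphism isRingIsomorphism public
      using (+-homo; *-homo; -‿homo; 0#-homo; 1#-homo; injective; surjective)
      renaming (⟦⟧-cong to act-cong)

    horner-homo : ∀ {b} → act b ≈ b → (p : Vec Carrier n) → ∀ x →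
                  act (horner b p x) ≈ horner b (Vec.map act p) (act x)
    horner-homo σb≈b []      x = σb≈b
    horner-homo σb≈b (a ∷ p) x =
      trans (+-homo _ _) (+-congˡ (trans (*-homo _ _) (*-congˡ (horner-homo σb≈b p x))))

    ∏-homo : (rs : Vec Carrier n) → ∀ x → act ((∏X- rs) x) ≈ (∏X- Vec.map act rs) (act x)
    ∏-homo []       x = 1#-homo
    ∏-homo (r ∷ rs) x = trans (*-homo _ _)
      (*-cong (trans (+-homo _ _) (+-congˡ (-‿homo r))) (∏-homo rs x))

    fixes-coefficients : Fixes σ ⟨ xs ⟩ → (p : Vec Carrier n) → ⟨ toList p ⟩ ⊆ ⟨ xs ⟩ →
                         Pointwise _≈_ (Vec.map act p) p
    fixes-coefficients fixes []      p⊆xs = []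
    fixes-coefficients fixes (a ∷ p) p⊆xs =
      fixes (p⊆xs (here refl)) ∷ fixes-coefficients fixes p (p⊆xs ∘ there)

    ∈-map-act : (p : Vec Carrier n) → ∀ {a} → a ∈ₗ toList p → act a ∈ₗ toList (Vec.map act p)
    ∈-map-act (b ∷ p) (here a≈b) = here (act-cong a≈b)
    ∈-map-act (b ∷ p) (there a∈) = there (∈-map-act p a∈)

    image-list : ∀ xs → ⟨ List.map act xs ⟩ ⊆ image σ ⟨ xs ⟩
    image-list (x ∷ xs) (here y≈σx) = x , here refl , sym y≈σx
    image-list (x ∷ xs) (there y∈)  with z , z∈xs , σz≈y ← image-list xs y∈ =
      z , there z∈xs , σz≈y

    -- By invariance, an element of the closure of the image is the image of an element of the
    -- closure, and injectivity identifies that element with `t`.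
    independent-image : (ts : Vec Carrier n) → IndependentOver xs ts →
                        IndependentOver (List.map act xs) (Vec.map act ts)
    independent-image []       _          = tt
    independent-image {xs = xs} (t ∷ ts) (t∉ , ind) =
      (λ σt∈ → let z , z∈ , σz≈σt = proj₂ (invariant σ ⟨ xs ⟩) (monotone (image-list xs) σt∈)
               in t∉ (cl-resp-≈ _ (injective σz≈σt) z∈)) ,
      independent-image ts ind

    preimage : ∀ x → ∃[ y ] act y ≈ x
    preimage x with y , σy≈x ← surjective x = y , σy≈x refl

  identity : Automorphism K
  identity = record { isRingIsomorphism = Identity.isRingIsomorphism _ refl }

  infixr 9 _∘ᴬ_
  _∘ᴬ_ : Automorphism K → Automorphism K → Automorphism K
  τ ∘ᴬ σ = record { isRingIsomorphism = Composition.isRingIsomorphism trans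
    (Automorphism.isRingIsomorphism σ) (Automorphism.isRingIsomorphism τ) }

  -- After `t` is moved to `c` over `xs`, the images of `ts` are independent over `c` and `xs`. The
  -- remaining entries are then moved by an automorphism that also fixes `c`.
  homogeneous : ∀ xs (ts cs : Vec Carrier n) → IndependentOver xs ts → IndependentOver xs cs →
                ∃ λ (σ : Automorphism K) → Fixes σ ⟨ xs ⟩ ×
                       Pointwise _≈_ (Vec.map ⟦ σ ⟧ ts) cs
  homogeneous xs []       []       _          _          = identity , (λ _ → refl) , []
  homogeneous xs (t ∷ ts) (c ∷ cs) (t∉ , ts-ind) (c∉ , cs-ind) =
    let σ , _ , σ-fixes , σt≈c = ω-homogeneous xs t∉ c∉
        τ , τ-fixes , τσts≈cs  = homogeneous (c ∷ xs) (Vec.map ⟦ σ ⟧ ts) cs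
          (independent-antitone _ (moved σ σ-fixes σt≈c) (Action.independent-image σ ts ts-ind))
          cs-ind
    in τ ∘ᴬ σ ,
       (λ x∈xs → trans (Action.act-cong τ (σ-fixes x∈xs)) (τ-fixes (there x∈xs))) ,
       trans (Action.act-cong τ σt≈c) (τ-fixes (here refl)) ∷ map-∘ σ τ ts τσts≈cs
    where
    map-∘ : ∀ σ τ (ts : Vec Carrier m) {cs : Vec Carrier m} →
            Pointwise _≈_ (Vec.map (Action.act τ) (Vec.map (Action.act σ) ts)) cs →
            Pointwise _≈_ (Vec.map (Action.act (τ ∘ᴬ σ)) ts) cs
    map-∘ σ τ []       []       = []
    map-∘ σ τ (t ∷ ts) (e ∷ es) = e ∷ map-∘ σ τ ts es

    moved : ∀ σ → Fixes σ ⟨ xs ⟩ → ⟦ σ ⟧ t ≈ c →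
            ⟨ c ∷ xs ⟩ ⊆ ⟨ List.map ⟦ σ ⟧ (t ∷ xs) ⟩
    moved σ fixes σt≈c (here x≈c)   = here (trans x≈c (sym σt≈c))
    moved σ fixes σt≈c (there x∈xs) = there (Membership.∈-resp-≈ setoid (fixes x∈xs)
      (Membership.∈-map⁺ setoid setoid (Action.act-cong σ) x∈xs))

  -- Over `xs`, an element outside the closure can be moved to any other element outside it, and one
  -- of these avoids the finite list `R`.
  finite-orbit : ∀ xs R {a} → (∀ σ → Fixes σ ⟨ xs ⟩ → ⟦ σ ⟧ a ∈ₗ R) →
                 a ∈ cl ⟨ xs ⟩
  finite-orbit xs R {a} orbit⊆R = decidable-stable em λ a∉ →
    let b , b∉           = generic (R ++ xs)
        σ , _ , fixes , σa≈b = ω-homogeneous xs a∉ (b∉ ∘ cl-weakenʳ R)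
    in b∉ (extensive _ (Membership.∈-++⁺ˡ setoid
         (Membership.∈-resp-≈ setoid σa≈b (orbit⊆R σ fixes))))

  -- An automorphism fixing `e` sends roots to roots, so each root has a finite orbit over `e` and
  -- `xs`. Thus the m coefficients span m independent elements.
  independent-coefficients : ∀ xs (r e : Vec Carrier m) → (∀ x → (∏X- r) x ≈ monic e x) →
                             IndependentOver xs r → IndependentOver xs e
  independent-coefficients xs r e ∏≈e r-ind =
    spanning⇒independent r e r-ind λ {a} a∈r →
      finite-orbit (toList e ++ xs) (toList r) λ σ fixes →
      let open Action σ in roots-∏ r (begin
        (∏X- r) (act a)                ≈⟨ ∏≈e (act a) ⟩
        monic e (act a)
          ≈⟨ horner-cong (fixes-coefficients fixes e (Membership.∈-++⁺ˡ setoid)) refl ⟨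
        monic (Vec.map act e) (act a)  ≈⟨ horner-homo 1#-homo e a ⟨
        act (monic e a)                ≈⟨ act-cong (∏≈e a) ⟨
        act ((∏X- r) a)                ≈⟨ act-cong (∏-root r a∈r) ⟩
        act 0#                         ≈⟨ 0#-homo ⟩
        0#                             ∎)

  -- A product of linear factors with independent roots also has independent coefficients.
  -- Homogeneity carries these to `g`, and the factorisation along with them.
  generic-splits : ∀ xs (g : Vec Carrier m) → IndependentOver xs g →
                   ∃[ rs ] ∀ x → monic g x ≈ (∏X-_ {m} rs) x
  generic-splits xs g g-ind =
    let r , r-ind    = independent-tuple generic _ xs
        e , ∏≈e      = monic-∏ r
        σ , _ , σe≈g = homogeneous xs e g (independent-coefficients xs r e ∏≈e r-ind) g-ind
        open Action σ
    -- Each point `x` is the image of some `y`, at which the factorisation of `e` is transported.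
    in Vec.map act r , λ x → let y , σy≈x = preimage x in begin
      monic g x                      ≈⟨ horner-cong σe≈g σy≈x ⟨
      monic (Vec.map act e) (act y)  ≈⟨ horner-homo 1#-homo e y ⟨
      act (monic e y)                ≈⟨ act-cong (∏≈e y) ⟨
      act ((∏X- r) y)                ≈⟨ ∏-homo r y ⟩
      (∏X- Vec.map act r) (act y)    ≈⟨ ∏-congʳ (Vec.map act r) σy≈x ⟩
      (∏X- Vec.map act r) x          ∎

  -- The contradiction from a rootless polynomial of least degree at least two.

  module _
    (f : Vec Carrier (suc (suc n)))
    (irreducible : ¬ (∃[ x ] monic f x ≈ 0#))
    (lower : ∀ {m} → m ℕ.< suc n → (g : Vec Carrier (suc m)) → ∃[ x ] monic g x ≈ 0#)
    where
    open Modulus infinite f irreducible lower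
    open Quotient using (coordinates)

    private
      F : List Carrier
      F = toList f

    -- An automorphism fixing the coefficients of `f` acts on K[X]/(f) coordinatewise; if it also
    -- fixes those of `g`, it sends roots of `g` to roots of `g`.
    f∣-action : ∀ σ (g : Vec Carrier m) (t : Vec Carrier (suc (suc n))) →
                Fixes σ ⟨ toList g ++ F ⟩ → f∣ (λ x → monic g (poly t x)) →
                f∣ (λ x → monic g (poly (Vec.map (Action.act σ) t) x))
    f∣-action σ g t fixes (q , (_ , p , q≈p) , gt≈fq) =
      poly (Vec.map act p) , IsPoly-poly (Vec.map act p) , eq
      where
      open Action σ
      eq : ∀ x → monic g (poly (Vec.map act t) x) ≈ monic f x * poly (Vec.map act p) x
      eq x with y , σy≈x ← preimage x = begin
        monic g (poly (Vec.map act t) x)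
          ≈⟨ horner-cong (fixes-coefficients fixes g (Membership.∈-++⁺ˡ setoid))
                         (trans (horner-homo 0#-homo t y) (horner-congʳ (Vec.map act t) σy≈x)) ⟨
        monic (Vec.map act g) (act (poly t y))
          ≈⟨ horner-homo 1#-homo g (poly t y) ⟨
        act (monic g (poly t y))
          ≈⟨ act-cong (trans (gt≈fq y) (*-congˡ (q≈p y))) ⟩
        act (monic f y * poly p y)
          ≈⟨ *-homo _ _ ⟩
        act (monic f y) * act (poly p y)
          ≈⟨ *-cong (horner-homo 1#-homo f y) (horner-homo 0#-homo p y) ⟩
        monic (Vec.map act f) (act y) * poly (Vec.map act p) (act y)
          ≈⟨ *-cong (horner-cong (fixes-coefficients fixes f
                                    (Membership.∈-++⁺ʳ setoid (toList g))) σy≈x)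
                    (horner-congʳ (Vec.map act p) σy≈x) ⟩
        monic f x * poly (Vec.map act p) x ∎

    -- Over the coefficients of `f` and `g`, every conjugate of an entry of `t` is a coordinate of
    -- one of the finitely many roots of `g` in K[X]/(f). Hence `g` spans `t`.
    independent-relation : (t g : Vec Carrier (suc (suc n))) → IndependentOver F t →
                           f∣ (λ x → monic g (poly t x)) → IndependentOver F g
    independent-relation t g t-ind f∣gt =
      let R , all = coordinates g
      in spanning⇒independent t g t-ind λ a∈t → finite-orbit (toList g ++ F) R λ σ fixes →
           all (f∣-action σ g t fixes f∣gt) (Action.∈-map-act σ t a∈t)

    -- If `t` were congruent to a constant, uniqueness of coordinates would make `t₁` zero. Zero is
    -- fixed by all automorphisms, so it lies in every finitely generated closure.
    independent⇒nonlinear : (t : Vec Carrier (suc (suc n))) → IndependentOver F t → ∀ r →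
                            ¬ f∣ (λ x → poly t x - r)
    independent⇒nonlinear (t₀ ∷ t₁ ∷ t) (_ , t₁∉ , _) r f∣t-r
      with _ ∷ t₁≈0 ∷ _ ← f∣poly⇒zero (t₀ - r ∷ t₁ ∷ t) (f∣-resp
             (λ x → solve 3 (λ a u r → (a :+ u) :- r := (a :- r) :+ u) refl
                      t₀ (x * poly (t₁ ∷ t) x) r)
             f∣t-r) =
      t₁∉ (finite-orbit (t₀ ∷ F) (0# ∷ []) λ σ _ →
        here (trans (Action.act-cong σ t₁≈0) (Action.0#-homo σ)))

    irreducible⇒⊥ : ⊥
    irreducible⇒⊥ =
      let t , t-ind          = independent-tuple generic (suc (suc n)) F
          m , m≤N , g , f∣gt = relation (IsPoly-poly t)
          rs , g≈∏           = splits (ℕ.m≤n⇒m<n∨m≡n m≤N) t t-ind g f∣gt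
          r , f∣t-r          = divides-factor rs (IsPoly-poly t)
                                 (f∣-resp (λ x → g≈∏ (poly t x)) f∣gt)
      in independent⇒nonlinear t t-ind r f∣t-r
      where
      splits : m ℕ.< suc (suc n) ⊎ m ≡ suc (suc n) →
               (t : Vec Carrier (suc (suc n))) → IndependentOver F t →
               (g : Vec Carrier m) → f∣ (λ x → monic g (poly t x)) →
               ∃[ rs ] ∀ x → monic g x ≈ (∏X-_ {m} rs) x
      -- Below the degree of `f` the polynomial splits by minimality; in the same degree it splits
      -- because its coefficients are independent.
      splits (inj₁ (s≤s m≤n)) t t-ind g f∣gt = split m≤n g
      splits (inj₂ ≡.refl)    t t-ind g f∣gt =
        generic-splits F g (independent-relation t g t-ind f∣gt)

  -- Existence of roots.

  monic-root : ∀ n (f : Vec Carrier (suc n)) → ∃[ x ] monic f x ≈ 0#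
  monic-root = <-rec _ λ where
    -- The index n stands for degree n + 1, so the base case is linear and a least counterexample
    -- has degree at least two.
    zero    lower (a ∷ []) → - a , solve 1 (λ a → a :+ (:- a) :* con 1ℤ := con 0ℤ) refl a
    (suc n) lower f        → decidable-stable em λ irreducible →
      irreducible⇒⊥ f irreducible lower

  eval≈poly : ∀ p x → eval K p x ≈ poly (fromList p) x
  eval≈poly []      x = refl
  eval≈poly (a ∷ p) x = +-congˡ (*-congˡ (eval≈poly p x))

  nonzero : ∀ {p} → Any (λ b → ¬ (b ≈ 0#)) p → ¬ VecAll.All (_≈ 0#) (fromList p)
  nonzero (here b≉0) (b≈0 ∷ _) = b≉0 b≈0
  nonzero (there ≉0) (_ ∷ p≈0) = nonzero ≉0 p≈0

  algebraicallyClosed : AlgebraicallyClosed K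
  algebraicallyClosed a p p≉0 with normalise (fromList p)
  ... | inj₁ p≈0 = contradiction p≈0 (nonzero p≉0)
  ... | inj₂ (b , b≉0 , k , _ , g , p≈bg) =
    let y , by≈1 = inverse b≉0
        -- Dividing by the leading coefficient `b` leaves a monic polynomial of degree k + 1.
        x , root = monic-root k (y * a ∷ g)
    in x , (begin
      eval K (a ∷ p) x               ≈⟨ eval≈poly (a ∷ p) x ⟩
      a + x * poly (fromList p) x    ≈⟨ +-cong (sym (*-identityˡ a)) (*-congˡ (p≈bg x)) ⟩
      1# * a + x * (b * monic g x)   ≈⟨ +-congʳ (*-congʳ by≈1) ⟨
      b * y * a + x * (b * monic g x)
        ≈⟨ solve 5 (λ a b y x u → b :* y :* a :+ x :* (b :* u) := b :* (y :* a :+ x :* u)) refl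
             a b y x (monic g x) ⟩
      b * (y * a + x * monic g x)    ≈⟨ *-congˡ root ⟩
      b * 0#                         ≈⟨ zeroʳ b ⟩
      0#                             ∎)

theorem2p13 : (∀ {ℓ} → ExcludedMiddle ℓ) →
    ∀ {c ℓ₁ ℓ₂} (K : HeytingField c ℓ₁ ℓ₂) →
    ωHomogeneousPregeometry K → AlgebraicallyClosed K
theorem2p13 em K H = HomogeneousField.algebraicallyClosed em K H
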